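{- Let $k\ge 2$ and $r$ be integers with $1\le r\le k$, let $A_r=\{a_1,a_2,\ldots,a_r\}\subseteq\{0,1,\ldots,k-1\}$ be a set with exactly $r$ elements, and put $n=f_k(A_r)$. Then $n$ divides $k$, and $d=k/n$ is a positive integer that divides $r$; that is, $k=nd$ and $r=md$ for a positive integer $m$. Furthermore, $$|\mathcal{A}_n(r,k)|=\sum_{s\mid (n,m)}\binom{n/s}{m/s}\mu(s),$$ where the sum is taken over all positive divisors $s$ of the greatest common divisor $(n,m)$ of $n$ and $m$. In particular, $$|\mathcal{A}_k(r,k)|=\sum_{s\mid (k,r)}\binom{k/s}{r/s}\mu(s).$$
   Context: For a finite set $A$ of nonnegative integers and a positive integer $i$, let $\overline{A}(i)\subseteq\{0,1,\ldots,i-1\}$ be the set of residues modulo $i$ of the elements of $A$; two finite sets $A,B$ are called equal modulo $i$ if $\overline{A}(i)=\overline{B}(i)$. Write $A+t=\{a+t: a\in A\}$. For integers $1\le j\le i$, $\mathcal{A}(j,i)$ denotes the collection of all subsets of $\{0,1,\ldots,i-1\}$ with exactly $j$ elements. For $A\in\mathcal{A}(j,i)$, $f_i(A)$ denotes the smallest positive integer $l$ such that $A$ equals $A+l$ modulo $i$ (it exists and is at most $i$). For $1\le s\le i$, $\mathcal{A}_s(j,i)=\{A\in\mathcal{A}(j,i): f_i(A)=s\}$. $(x,y)$ denotes the greatest common divisor, $|\cdot|$ cardinality, and $\mu$ the Möbius function. -}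

module Defs where

open import Data.Bool.Properties using () renaming (_≟_ to _≟ᵇ_)
open import Data.Empty using (⊥-elim)
open import Data.Fin using (toℕ)
open import Data.Fin.Properties using (fromℕ<-cong)
open import Data.Fin.Subset using (Subset; inside; outside; ⋃; ⁅_⁆; ∣_∣)
open import Data.Fin.Subset.Properties using (_∈?_)
open import Data.Integer using (ℤ; 0ℤ; -1ℤ) renaming (_+_ to _+ᶻ_; _^_ to _^ᶻ_)
open import Data.List using (List; []; _∷_; _++_; map; filter; foldr; length; upTo; allFin)
open import Data.List.Membership.Propositional using (_∈_)
open import Data.List.Membership.Propositional.Properties using (∈-++⁺ˡ; ∈-++⁺ʳ; ∈-map⁺; ∈-map⁻)
open import Data.List.Properties using (map-cong; map-∘)
open import Data.List.Relation.Unary.All using ([])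
open import Data.List.Relation.Unary.AllPairs using ([]; _∷_)
open import Data.List.Relation.Unary.Any using (here)
open import Data.List.Relation.Unary.Unique.Propositional using (Unique)
open import Data.List.Relation.Unary.Unique.Propositional.Properties using (map⁺; ++⁺)
open import Data.Nat using (ℕ; zero; suc; _+_; _≤_; _<_; _≟_; _<?_; z≤n; NonZero; >-nonZero⁻¹)
open import Data.Nat.Divisibility using (_∣?_)
open import Data.Nat.DivMod using (_%_; _mod_; [m+n]%n≡m%n; m%n<n)
open import Data.Nat.Primality.Factorisation using (factorise; factors)
open import Data.Nat.Properties using (+-identityʳ; +-suc; ≤∧≢⇒<)
open import Data.Product using (∃; _×_; _,_; proj₁; proj₂)
open import Data.Vec using ([]; _∷_)
open import Data.Vec.Properties using (≡-dec; ∷-injectiveʳ)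
open import Relation.Binary.PropositionalEquality using (_≡_; refl; sym; trans; cong; subst)
open import Relation.Nullary using (yes; no)
open import Relation.Nullary.Decidable using (_×-dec_)
open import Relation.Unary using (Pred; Decidable)
open import Level using (0ℓ)
import Data.List.Relation.Unary.Unique.DecPropositional as DecUnique

-- Finite sets of nonnegative integers are represented by lists; multiplicities
-- and order play no role, because lists are only compared via `residues`.

residues : (i : ℕ) → .{{_ : NonZero i}} → List ℕ → Subset i
residues i A = ⋃ (map (λ a → ⁅ a mod i ⁆) A)

EqualModulo : (i : ℕ) → .{{_ : NonZero i}} → List ℕ → List ℕ → Set
EqualModulo i A B = residues i A ≡ residues i B

infixl 6 _⊕_
_⊕_ : List ℕ → ℕ → List ℕ
A ⊕ t = map (_+ t) A

elements : ∀ {i} → Subset i → List ℕ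
elements {i} A = map toℕ (filter (_∈? A) (allFin i))

IsLeast : Pred ℕ 0ℓ → Pred ℕ 0ℓ
IsLeast P l = P l × (∀ l′ → P l′ → l ≤ l′)

least : ∀ {P : Pred ℕ 0ℓ} → Decidable P → ∀ n → P n → ∃ (IsLeast P)
least {P} P? n pn = search n 0 (λ _ _ → z≤n) (subst P (sym (+-identityʳ n)) pn)
  where
  search : ∀ gas l → (∀ l′ → P l′ → l ≤ l′) → P (gas + l) → ∃ (IsLeast P)
  search gas l low p with P? l
  ... | yes pl = l , pl , low
  search zero      l low p | no ¬pl = ⊥-elim (¬pl p)
  search (suc gas) l low p | no ¬pl =
    search gas (suc l)
      (λ l′ pl′ → ≤∧≢⇒< (low l′ pl′) (λ eq → ¬pl (subst P (sym eq) pl′)))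
      (subst P (sym (+-suc gas l)) p)

IsShift : (i : ℕ) → .{{_ : NonZero i}} → Subset i → Pred ℕ 0ℓ
IsShift i A l = 0 < l × EqualModulo i (elements A) (elements A ⊕ l)

isShift? : (i : ℕ) → .{{_ : NonZero i}} → (A : Subset i) → Decidable (IsShift i A)
isShift? i A l =
  (0 <? l) ×-dec ≡-dec _≟ᵇ_ (residues i (elements A)) (residues i (elements A ⊕ l))

isShift-modulus : (i : ℕ) → .{{_ : NonZero i}} → (A : Subset i) → IsShift i A i
isShift-modulus i A =
  >-nonZero⁻¹ i , cong ⋃ (trans (map-cong same (elements A)) (map-∘ (elements A)))
  where
  same : ∀ a → ⁅ a mod i ⁆ ≡ ⁅ (a + i) mod i ⁆
  same a = cong ⁅_⁆
    (fromℕ<-cong (a % i) ((a + i) % i) (sym ([m+n]%n≡m%n a i)) (m%n<n a i) (m%n<n (a + i) i))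

f-least : (i : ℕ) → .{{_ : NonZero i}} → (A : Subset i) → ∃ (IsLeast (IsShift i A))
f-least i A = least (isShift? i A) i (isShift-modulus i A)

f : (i : ℕ) → .{{_ : NonZero i}} → Subset i → ℕ
f i A = proj₁ (f-least i A)

subsets : (i : ℕ) → List (Subset i)
subsets zero    = [] ∷ []
subsets (suc i) = map (outside ∷_) (subsets i) ++ map (inside ∷_) (subsets i)

∈-subsets : ∀ {i} (A : Subset i) → A ∈ subsets i
∈-subsets []            = here refl
∈-subsets (outside ∷ A) = ∈-++⁺ˡ (∈-map⁺ (outside ∷_) (∈-subsets A))
∈-subsets (inside ∷ A)  = ∈-++⁺ʳ _ (∈-map⁺ (inside ∷_) (∈-subsets A))

subsets-unique : ∀ i → Unique (subsets i)
subsets-unique zero    = [] ∷ []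
subsets-unique (suc i) =
  ++⁺ (map⁺ ∷-injectiveʳ (subsets-unique i)) (map⁺ ∷-injectiveʳ (subsets-unique i)) disjoint
  where
  disjoint : ∀ {A} → A ∈ map (outside ∷_) (subsets i) × A ∈ map (inside ∷_) (subsets i) → _
  disjoint (p , q) with ∈-map⁻ (outside ∷_) p | ∈-map⁻ (inside ∷_) q
  ... | _ , _ , refl | _ , _ , ()

-- Both families are duplicate-free lists, so `length` is their cardinality.

𝒜 : (j i : ℕ) → List (Subset i)
𝒜 j i = filter (λ A → ∣ A ∣ ≟ j) (subsets i)

𝒜[_] : (s j i : ℕ) → .{{_ : NonZero i}} → List (Subset i)
𝒜[ s ] j i = filter (λ A → f i A ≟ s) (𝒜 j i)

μ : (n : ℕ) → .{{_ : NonZero n}} → ℤ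
μ n with DecUnique.unique? _≟_ (factors (factorise n))
... | yes _ = -1ℤ ^ᶻ length (factors (factorise n))
... | no  _ = 0ℤ

sumᶻ : List ℤ → ℤ
sumᶻ = foldr _+ᶻ_ 0ℤ

-- The sum of F s over the positive divisors s = suc t of N, for N positive.
∑∣ : (N : ℕ) → (F : (s : ℕ) → .{{_ : NonZero s}} → ℤ) → ℤ
∑∣ N F = sumᶻ (map (λ t → F (suc t)) (filter (λ t → suc t ∣? N) (upTo N)))

infix 3 ∑∣
syntax ∑∣ N (λ s → e) = ∑[ s ∣ N ] e

{-# OPTIONS --safe #-}

-- A set A ⊆ ℤ/k with least period f(A) has period l exactly when f(A) ∣ l, and
-- for n ∣ k the n-periodic sets correspond to the subsets of ℤ/n by tiling. With
-- k = n d and r = m d, the number C(n/s, m/s) thus counts the A of size r with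
-- f(A) ∣ n/s. Exchanging the sums over s and A turns the right-hand side into
-- Σ_A Σ_s μ(s), where s runs over the divisors of n / f(A) if f(A) ∣ n and over
-- nothing otherwise; the inner sum is 1 if f(A) = n and 0 if not.

module Submission where

open import Defs
open import Data.Bool using (Bool; true; false)
open import Data.Bool.Properties using (⇔→≡)
open import Data.Empty using (⊥-elim)
open import Data.Fin using (Fin; toℕ)
open import Data.Fin.Properties using (toℕ<n; toℕ-fromℕ<; toℕ-injective)
open import Data.Fin.Subset using (Subset; inside; outside; ⁅_⁆; ∣_∣) renaming (_∈_ to _∈ˢ_)
open import Data.Fin.Subset.Properties
  using (_∈?_; ∉⊥; x∈p∪q⁻; x∈p∪q⁺; x∈⁅x⁆; x∈⁅y⁆⇒x≡y; ⊆-antisym)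
open import Data.Integer using (ℤ; +_; 0ℤ; 1ℤ; -1ℤ)
  renaming (_+_ to _+ᶻ_; _*_ to _*ᶻ_; -_ to -ᶻ_; _^_ to _^ᶻ_)
import Data.Integer.Properties as ℤ
open import Algebra.Properties.CommutativeSemigroup ℤ.+-commutativeSemigroup
  using (interchange; x∙yz≈y∙xz)
open import Data.List using (List; []; _∷_; _++_; map; filter; length; upTo; allFin)
open import Data.List.Membership.Propositional using (_∈_)
open import Data.List.Membership.Propositional.Properties
  using (∈-filter⁺; ∈-filter⁻; ∈-map⁺; ∈-map⁻; ∈-upTo⁺; ∈-allFin)
open import Data.List.Membership.Propositional.Properties.WithK using (unique∧set⇒bag)
open import Data.List.Properties
  using (map-∘; filter-++; filter-none; filter-≐; length-++; length-map)
open import Data.List.Relation.Binary.BagAndSetEquality using (∼bag⇒↭)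
open import Data.List.Relation.Binary.Permutation.Propositional using (_↭_; ↭-sym; ↭⇒↭ₛ)
open import Data.List.Relation.Binary.Permutation.Propositional.Properties
  using (↭-length) renaming (map⁺ to ↭-map⁺)
open import Data.List.Relation.Binary.Permutation.Setoid.Properties
  using (foldr-commMonoid; Unique-resp-↭)
open import Data.List.Relation.Unary.All as All using ([]; _∷_)
open import Data.List.Relation.Unary.All.Properties using (¬Any⇒All¬; All¬⇒¬Any)
open import Data.List.Relation.Unary.AllPairs using ([]; _∷_)
open import Data.List.Relation.Unary.Any using (here; there)
open import Data.List.Relation.Unary.Unique.Propositional using (Unique)
open import Data.List.Relation.Unary.Unique.Propositional.Properties using (map⁺; filter⁺; upTo⁺)
open import Data.Nat hiding (_!)
open import Data.Nat.Combinatorics using (_C_; nCk+nC[k+1]≡[n+1]C[k+1])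
open import Data.Nat.Coprimality using (Coprime; coprime-divisor)
open import Data.Nat.DivMod
open import Data.Nat.Divisibility
open import Data.Nat.GCD using (gcd; gcd[m,n]∣m; gcd[m,n]∣n; gcd-greatest; gcd[m,n]≢0)
open import Data.Nat.ListAction using (product)
open import Data.Nat.ListAction.Properties using (∈⇒∣product)
open import Data.Nat.Primality using (Prime; prime⇒irreducible; ¬prime[0])
open import Data.Nat.Primality.Factorisation
open import Data.Nat.Properties
open import Data.Product using (∃-syntax; _×_; _,_; proj₁; proj₂)
open import Data.Sum using (inj₁; inj₂)
open import Data.Vec using (_∷_; lookup; tabulate)
open import Data.Vec.Properties
  using (lookup∘tabulate; tabulate∘lookup; tabulate-cong; []=⇒lookup; lookup⇒[]=)
open import Function using (_∘_; _⇔_; mk⇔; it)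
open import Level using (0ℓ)
open import Relation.Binary.PropositionalEquality
open import Relation.Nullary using (¬_; yes; no; Dec; ¬?)
open import Relation.Unary using (Pred; Decidable)
import Data.List.Relation.Unary.Unique.DecPropositional as DecUnique


open PrimeFactorisation using (isFactorisation; factorsPrime)

private variable
  X Y : Set
  P : Pred X 0ℓ

-- Finite integer sums over lists.

-- Lists without repetition that have the same members are equal as bags. Every reindexing of a sum
-- or a count below is thereby reduced to two membership implications.
⇔⇒↭ : {xs ys : List X} → Unique xs → Unique ys → (∀ {x} → x ∈ xs ⇔ x ∈ ys) → xs ↭ ys
⇔⇒↭ !xs !ys eq = ∼bag⇒↭ (unique∧set⇒bag !xs !ys eq)

∑ : List X → (X → ℤ) → ℤ
∑ xs g = sumᶻ (map g xs)

∑-cong : ∀ {xs : List X} {g h} → (∀ {x} → x ∈ xs → g x ≡ h x) → ∑ xs g ≡ ∑ xs h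
∑-cong {xs = []}     eq = refl
∑-cong {xs = x ∷ xs} eq = cong₂ _+ᶻ_ (eq (here refl)) (∑-cong (eq ∘ there))

∑-↭ : ∀ {xs ys : List X} g → xs ↭ ys → ∑ xs g ≡ ∑ ys g
∑-↭ g p = foldr-commMonoid (setoid ℤ) ℤ.+-0-isCommutativeMonoid (↭⇒↭ₛ (↭-map⁺ g p))

∑-neg : ∀ (xs : List X) g → ∑ xs (-ᶻ_ ∘ g) ≡ -ᶻ ∑ xs g
∑-neg []       g = refl
∑-neg (x ∷ xs) g =
  trans (cong (-ᶻ g x +ᶻ_) (∑-neg xs g)) (sym (ℤ.neg-distrib-+ (g x) (∑ xs g)))

∑-split : ∀ (P? : Decidable P) (xs : List X) g →
          ∑ xs g ≡ ∑ (filter P? xs) g +ᶻ ∑ (filter (¬? ∘ P?) xs) g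
∑-split P? []       g = refl
∑-split P? (x ∷ xs) g with P? x
... | yes _ = trans (cong (g x +ᶻ_) (∑-split P? xs g)) (sym (ℤ.+-assoc (g x) _ _))
... | no  _ = trans (cong (g x +ᶻ_) (∑-split P? xs g)) (x∙yz≈y∙xz (g x) (∑ (filter P? xs) g) _)

∑-zero : ∀ {xs : List X} {g} → (∀ {x} → x ∈ xs → g x ≡ 0ℤ) → ∑ xs g ≡ 0ℤ
∑-zero {xs = []}     eq = refl
∑-zero {xs = x ∷ xs} eq = cong₂ _+ᶻ_ (eq (here refl)) (∑-zero (eq ∘ there))

-- Double counting of the pairs with `Q y x`, each of weight `g y`: grouped by `y` the weight is
-- multiplied by a cardinality, grouped by `x` it is summed over the admissible `y`.
∑-fubini : {Q : Y → Pred X 0ℓ} (Q? : ∀ b → Decidable (Q b)) (xs : List X) (ys : List Y) (g : Y → ℤ) →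
           ∑ ys (λ y → + length (filter (Q? y) xs) *ᶻ g y) ≡
           ∑ xs (λ x → ∑ (filter (λ y → Q? y x) ys) g)
∑-fubini Q? xs []       g = sym (∑-zero {xs = xs} (λ _ → refl))
∑-fubini Q? xs (y ∷ ys) g =
  trans (cong (+ length (filter (Q? y) xs) *ᶻ g y +ᶻ_) (∑-fubini Q? xs ys g)) (sym (step xs))
  where
  inner : _ → ℤ
  inner x = ∑ (filter (λ y → Q? y x) ys) g
  step : ∀ xs → ∑ xs (λ x → ∑ (filter (λ y → Q? y x) (y ∷ ys)) g) ≡
                + length (filter (Q? y) xs) *ᶻ g y +ᶻ ∑ xs inner
  step []       = refl
  -- The single decision `Q? y x` governs both sides: whether `y` enters the inner sum of `x`, and
  -- whether `x` is counted for `y`.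
  step (x ∷ xs) with Q? y x
  ... | yes _ = begin
    g y +ᶻ inner x +ᶻ ∑ xs _             ≡⟨ cong (g y +ᶻ inner x +ᶻ_) (step xs) ⟩
    g y +ᶻ inner x +ᶻ (c *ᶻ g y +ᶻ rest) ≡⟨ interchange (g y) (inner x) (c *ᶻ g y) rest ⟩
    g y +ᶻ c *ᶻ g y +ᶻ (inner x +ᶻ rest) ≡⟨ cong (_+ᶻ (inner x +ᶻ rest)) (ℤ.suc-* c (g y)) ⟨
    (1ℤ +ᶻ c) *ᶻ g y +ᶻ (inner x +ᶻ rest) ∎
    where
    open ≡-Reasoning
    c rest : ℤ
    c    = + length (filter (Q? y) xs)
    rest = ∑ xs inner
  ... | no  _ = trans (cong (inner x +ᶻ_) (step xs)) (x∙yz≈y∙xz (inner x) (+ length (filter (Q? y) xs) *ᶻ g y) _)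

𝟙 : ∀ {P : Set} → Dec P → ℤ
𝟙 (yes _) = 1ℤ
𝟙 (no  _) = 0ℤ

𝟙-cong : ∀ {P Q : Set} (P? : Dec P) (Q? : Dec Q) → (P → Q) → (Q → P) → 𝟙 P? ≡ 𝟙 Q?
𝟙-cong (yes p) (yes q) to from = refl
𝟙-cong (yes p) (no ¬q) to from = ⊥-elim (¬q (to p))
𝟙-cong (no ¬p) (yes q) to from = ⊥-elim (¬p (from q))
𝟙-cong (no ¬p) (no ¬q) to from = refl

∑-𝟙 : (P? : Decidable P) (xs : List X) → ∑ xs (𝟙 ∘ P?) ≡ + length (filter P? xs)
∑-𝟙 P? []       = refl
∑-𝟙 P? (x ∷ xs) with P? x
... | yes _ = cong (1ℤ +ᶻ_) (∑-𝟙 P? xs)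
... | no  _ = trans (ℤ.+-identityˡ _) (∑-𝟙 P? xs)

-- Divisor sums of the Möbius function.

-- As in ∑∣, the list entry t encodes the divisor suc t.

divisors : ℕ → List ℕ
divisors N = filter (λ t → suc t ∣? N) (upTo N)

divisors-unique : ∀ N → Unique (divisors N)
divisors-unique N = filter⁺ (λ t → suc t ∣? N) (upTo⁺ N)

∈-divisors⁺ : ∀ {N t} .{{_ : NonZero N}} → suc t ∣ N → t ∈ divisors N
∈-divisors⁺ {N} t∣N = ∈-filter⁺ (λ t → suc t ∣? N) (∈-upTo⁺ (∣⇒≤ t∣N)) t∣N

∈-divisors⁻ : ∀ N {t} → t ∈ divisors N → suc t ∣ N
∈-divisors⁻ N t∈ = proj₂ (∈-filter⁻ (λ t → suc t ∣? N) {xs = upTo N} t∈)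

module _ {n} .{{_ : NonZero n}} (F : PrimeFactorisation n) where

  private
    canonical : factors F ↭ factors (factorise n)
    canonical = factorisationUnique F (factorise n)

  -- The definition of `μ` inspects the particular list computed by `factorise`. By unique
  -- factorisation `F` is a permutation of it, with the same length and the same repetitions, so a
  -- more convenient factorisation can be used instead.
  μ-squarefree : Unique (factors F) → μ n ≡ -1ℤ ^ᶻ length (factors F)
  μ-squarefree ! with DecUnique.unique? _≟_ (factors (factorise n))
  ... | yes _ = cong (-1ℤ ^ᶻ_) (sym (↭-length canonical))
  ... | no ¬! = ⊥-elim (¬! (Unique-resp-↭ (setoid ℕ) (↭⇒↭ₛ canonical) !))

  μ-squareful : ¬ Unique (factors F) → μ n ≡ 0ℤ
  μ-squareful ¬! with DecUnique.unique? _≟_ (factors (factorise n))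
  ... | yes ! = ⊥-elim (¬! (Unique-resp-↭ (setoid ℕ) (↭⇒↭ₛ (↭-sym canonical)) !))
  ... | no  _ = refl

module _ {p} (pr : Prime p) {s} .{{_ : NonZero s}} .{{_ : NonZero (p * s)}} where

  private
    Fs : PrimeFactorisation s
    Fs = factorise s

    -- With `p` in front of the factors of `s`, a repetition is either one already present for `s`
    -- or an occurrence of `p` among them, that is, `p ∣ s`.
    Fps : PrimeFactorisation (p * s)
    Fps = record
      { factors         = p ∷ factors Fs
      ; isFactorisation = cong (p *_) (isFactorisation Fs)
      ; factorsPrime    = pr ∷ factorsPrime Fs
      }

    ∣⇒∈ : p ∣ s → p ∈ factors Fs
    ∣⇒∈ p∣s = factorisationHasAllPrimeFactors pr
                (subst (p ∣_) (isFactorisation Fs) p∣s) (factorsPrime Fs)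

    ∈⇒∣ : p ∈ factors Fs → p ∣ s
    ∈⇒∣ p∈ = subst (p ∣_) (sym (isFactorisation Fs)) (∈⇒∣product p∈)

  μ-∣ : p ∣ s → μ (p * s) ≡ 0ℤ
  μ-∣ p∣s = μ-squareful Fps (λ { (p∉ ∷ _) → All¬⇒¬Any p∉ (∣⇒∈ p∣s) })

  μ-∤ : ¬ p ∣ s → μ (p * s) ≡ -ᶻ μ s
  μ-∤ p∤s with DecUnique.unique? _≟_ (factors Fs)
  ... | yes ! = trans (μ-squarefree Fps (¬Any⇒All¬ _ (p∤s ∘ ∈⇒∣) ∷ !)) (ℤ.-1*i≡-i _)
  -- In this branch `μ s` has reduced to zero, and so has its negation.
  ... | no ¬! = μ-squareful Fps (λ { (_ ∷ !) → ¬! ! })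

∃-primeDivisor : ∀ n .{{_ : NonZero n}} → n ≢ 1 → ∃[ p ] Prime p × p ∣ n
∃-primeDivisor n n≢1 with factorise n
... | record { factors = [] ; isFactorisation = eq } = ⊥-elim (n≢1 eq)
... | record { factors = p ∷ ps ; isFactorisation = eq ; factorsPrime = pr ∷ _ } =
  p , pr , subst (p ∣_) (sym eq) (m∣m*n (product ps))

∤⇒coprime : ∀ {p s} → Prime p → ¬ p ∣ s → Coprime s p
∤⇒coprime pr p∤s {i} (i∣s , i∣p) with prime⇒irreducible pr i∣p
... | inj₁ i≡1 = i≡1
... | inj₂ refl = ⊥-elim (p∤s i∣s)

-- The divisors of p * q prime to p are those of q, while the others are p * s
-- with s ∣ q and contribute - μ s if p ∤ s and 0 otherwise.

∑μ-prime* : ∀ {p} q .{{_ : NonZero q}} → Prime p → ∑ (divisors (p * q)) (λ t → μ (suc t)) ≡ 0ℤ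
∑μ-prime* {zero}      q pr = ⊥-elim (¬prime[0] pr)
∑μ-prime* {p@(suc p′)} q pr = begin
  ∑ (divisors (p * q)) M
    ≡⟨ ∑-split p∣? (divisors (p * q)) M ⟩
  ∑ (filter p∣? (divisors (p * q))) M +ᶻ ∑ (filter p∤? (divisors (p * q))) M
    ≡⟨ cong₂ _+ᶻ_ (∑-↭ M multiples) (∑-↭ M prime-to-p) ⟩
  ∑ (map p· (divisors q)) M +ᶻ ∑ R M
    ≡⟨ cong (λ l → sumᶻ l +ᶻ ∑ R M) (sym (map-∘ (divisors q))) ⟩
  ∑ (divisors q) (M ∘ p·) +ᶻ ∑ R M
    ≡⟨ cong (_+ᶻ ∑ R M) (∑-split p∣? (divisors q) (M ∘ p·)) ⟩
  (∑ (filter p∣? (divisors q)) (M ∘ p·) +ᶻ ∑ R (M ∘ p·)) +ᶻ ∑ R M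
    ≡⟨ cong (_+ᶻ ∑ R M) (cong₂ _+ᶻ_
         (∑-zero {xs = filter p∣? (divisors q)} {g = M ∘ p·} λ t∈ → μ-∣ pr (proj₂ (∈-filter⁻ p∣? {xs = divisors q} t∈)))
         (∑-cong {xs = R} {g = M ∘ p·} {h = -ᶻ_ ∘ M} λ t∈ → μ-∤ pr (proj₂ (∈-filter⁻ p∤? {xs = divisors q} t∈)))) ⟩
  (0ℤ +ᶻ ∑ R (-ᶻ_ ∘ M)) +ᶻ ∑ R M
    ≡⟨ cong (_+ᶻ ∑ R M) (trans (ℤ.+-identityˡ _) (∑-neg R M)) ⟩
  -ᶻ ∑ R M +ᶻ ∑ R M
    ≡⟨ ℤ.+-inverseˡ (∑ R M) ⟩
  0ℤ ∎
  where
  open ≡-Reasoning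
  instance
    _ : NonZero (p * q)
    _ = m*n≢0 p q

  M : ℕ → ℤ
  M t = μ (suc t)

  p∣? : Decidable (λ t → p ∣ suc t)
  p∣? t = p ∣? suc t

  p∤? : Decidable (λ t → ¬ p ∣ suc t)
  p∤? = ¬? ∘ p∣?

  R : List ℕ
  R = filter p∤? (divisors q)

  -- suc (p· t) = p * suc t holds definitionally
  p· : ℕ → ℕ
  p· t = t + p′ * suc t

  p·-injective : ∀ {t u} → p· t ≡ p· u → t ≡ u
  p·-injective {t} {u} eq = suc-injective (*-cancelˡ-≡ (suc t) (suc u) p (cong suc eq))

  multiples : filter p∣? (divisors (p * q)) ↭ map p· (divisors q)
  multiples = ⇔⇒↭ (filter⁺ p∣? (divisors-unique (p * q)))
                  (map⁺ p·-injective (divisors-unique q)) (mk⇔ to from)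
    where
    to : ∀ {t} → t ∈ filter p∣? (divisors (p * q)) → t ∈ map p· (divisors q)
    to {t} t∈ with ∈-filter⁻ p∣? {xs = divisors (p * q)} t∈
    -- A zero quotient would make `suc t` zero. Hence the quotient is some `suc u`, and `u` encodes
    -- the cofactor of `p`.
    ... | t∈D , divides (suc u) eq =
      subst (_∈ map p· (divisors q)) (sym t≡)
        (∈-map⁺ p· (∈-divisors⁺ (*-cancelˡ-∣ p
          (subst (_∣ p * q) (cong suc t≡) (∈-divisors⁻ (p * q) t∈D)))))
      where
      t≡ : t ≡ p· u
      t≡ = suc-injective (trans eq (*-comm (suc u) p))

    from : ∀ {t} → t ∈ map p· (divisors q) → t ∈ filter p∣? (divisors (p * q))
    from t∈ with ∈-map⁻ p· t∈
    ... | u , u∈ , refl = ∈-filter⁺ p∣? (∈-divisors⁺ (*-monoʳ-∣ p (∈-divisors⁻ q u∈))) (m∣m*n (suc u))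

  prime-to-p : filter p∤? (divisors (p * q)) ↭ R
  prime-to-p = ⇔⇒↭ (filter⁺ p∤? (divisors-unique (p * q)))
                   (filter⁺ p∤? (divisors-unique q)) (mk⇔ to from)
    where
    to : ∀ {t} → t ∈ filter p∤? (divisors (p * q)) → t ∈ R
    to t∈ with ∈-filter⁻ p∤? {xs = divisors (p * q)} t∈
    ... | t∈D , p∤t =
      ∈-filter⁺ p∤? (∈-divisors⁺ (coprime-divisor (∤⇒coprime pr p∤t) (∈-divisors⁻ (p * q) t∈D))) p∤t

    from : ∀ {t} → t ∈ R → t ∈ filter p∤? (divisors (p * q))
    from t∈ with ∈-filter⁻ p∤? {xs = divisors q} t∈
    ... | t∈D , p∤t = ∈-filter⁺ p∤? (∈-divisors⁺ (∣n⇒∣m*n p (∈-divisors⁻ q t∈D))) p∤t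

-- For `N = 1` both sides compute to 1. Otherwise some prime `p` divides `N`, and the divisors with
-- and without an additional factor `p` cancel.
∑μ≡𝟙 : ∀ N .{{_ : NonZero N}} → ∑ (divisors N) (λ t → μ (suc t)) ≡ 𝟙 (N ≟ 1)
∑μ≡𝟙 N with N ≟ 1
... | yes refl = refl
... | no N≢1 with ∃-primeDivisor N N≢1
...   | p , pr , p∣N@(divides q refl) =
  subst (λ N → ∑ (divisors N) (λ t → μ (suc t)) ≡ 0ℤ) (*-comm p q) (∑μ-prime* q pr)
  where
  instance
    _ : NonZero q
    _ = quotient≢0 p∣N

-- Periodic Boolean sequences and counting over periods.

Periodic : (ℕ → Bool) → ℕ → Set
Periodic g l = ∀ x → g (x + l) ≡ g x

periodic-* : ∀ {g l} q → Periodic g l → Periodic g (q * l)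
periodic-* {g} {l} zero    per x = cong g (+-identityʳ x)
periodic-* {g} {l} (suc q) per x = begin
  g (x + (l + q * l)) ≡⟨ cong g (+-assoc x l (q * l)) ⟨
  g (x + l + q * l)   ≡⟨ periodic-* q per (x + l) ⟩
  g (x + l)           ≡⟨ per x ⟩
  g x                 ∎
  where open ≡-Reasoning

periodic-∣ : ∀ {g l l′} → l ∣ l′ → Periodic g l → Periodic g l′
periodic-∣ (divides q refl) = periodic-* q

-- One step of the Euclidean algorithm on periods: `l % p` differs from `l` by a multiple of `p`.
-- Together with minimality this makes the least period divide every period.
periodic-% : ∀ {g l p} .{{_ : NonZero p}} → Periodic g l → Periodic g p → Periodic g (l % p)
periodic-% {g} {l} {p} per-l per-p x = begin
  g (x + l % p)               ≡⟨ periodic-* (l / p) per-p (x + l % p) ⟨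
  g (x + l % p + l / p * p)   ≡⟨ cong g (+-assoc x (l % p) (l / p * p)) ⟩
  g (x + (l % p + l / p * p)) ≡⟨ cong (λ y → g (x + y)) (m≡m%n+[m/n]*n l p) ⟨
  g (x + l)                   ≡⟨ per-l x ⟩
  g x                         ∎
  where open ≡-Reasoning

periodic-≡% : ∀ {g n} .{{_ : NonZero n}} → Periodic g n → ∀ x → g (x % n) ≡ g x
periodic-≡% {g} {n} per x = begin
  g (x % n)             ≡⟨ periodic-* (x / n) per (x % n) ⟨
  g (x % n + x / n * n) ≡⟨ cong g (m≡m%n+[m/n]*n x n) ⟨
  g x                   ∎
  where open ≡-Reasoning

bit : Bool → ℕ
bit true  = 1
bit false = 0

-- The recursion shifts the sequence, as `tabulate` does, so the comparison with the size of
-- `restrict g k` is a direct induction.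
count : (ℕ → Bool) → ℕ → ℕ
count g zero    = 0
count g (suc n) = bit (g 0) + count (g ∘ suc) n

count-cong : ∀ {g h} n → (∀ x → g x ≡ h x) → count g n ≡ count h n
count-cong zero    eq = refl
count-cong (suc n) eq = cong₂ _+_ (cong bit (eq 0)) (count-cong n (eq ∘ suc))

count-+ : ∀ g m n → count g (m + n) ≡ count g m + count (λ x → g (x + m)) n
count-+ g zero    n = count-cong n (λ x → cong g (sym (+-identityʳ x)))
count-+ g (suc m) n = begin
  bit (g 0) + count (g ∘ suc) (m + n)
    ≡⟨ cong (λ c → bit (g 0) + c) (count-+ (g ∘ suc) m n) ⟩
  bit (g 0) + (count (g ∘ suc) m + count (λ x → g (suc (x + m))) n)
    ≡⟨ +-assoc (bit (g 0)) _ _ ⟨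
  bit (g 0) + count (g ∘ suc) m + count (λ x → g (suc (x + m))) n
    ≡⟨ cong (λ c → bit (g 0) + count (g ∘ suc) m + c) (count-cong n (λ x → cong g (sym (+-suc x m)))) ⟩
  bit (g 0) + count (g ∘ suc) m + count (λ x → g (x + suc m)) n ∎
  where open ≡-Reasoning

count-periodic : ∀ {g} n d → Periodic g n → count g (d * n) ≡ d * count g n
count-periodic {g} n zero    per = refl
count-periodic {g} n (suc d) per = begin
  count g (n + d * n)                                ≡⟨ count-+ g n (d * n) ⟩
  count g n + count (λ x → g (x + n)) (d * n)        ≡⟨ cong (λ c → count g n + c) (count-cong (d * n) per) ⟩
  count g n + count g (d * n)                        ≡⟨ cong (λ c → count g n + c) (count-periodic n d per) ⟩
  count g n + d * count g n                          ∎
  where open ≡-Reasoning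

-- Subsets of ℤ/k as k-periodic sequences.

restrict : (ℕ → Bool) → ∀ k → Subset k
restrict g k = tabulate (g ∘ toℕ)

∣restrict∣ : ∀ g k → ∣ restrict g k ∣ ≡ count g k
∣restrict∣ g zero = refl
∣restrict∣ g (suc k) with g 0
... | true  = cong suc (∣restrict∣ (g ∘ suc) k)
... | false = ∣restrict∣ (g ∘ suc) k

restrict-cong : ∀ {g h} k → (∀ x → g x ≡ h x) → restrict g k ≡ restrict h k
restrict-cong k eq = tabulate-cong (eq ∘ toℕ)

toℕ-mod : ∀ x k .{{_ : NonZero k}} → toℕ (x mod k) ≡ x % k
toℕ-mod x k = toℕ-fromℕ< (m%n<n x k)

mod-toℕ : ∀ {k} .{{_ : NonZero k}} (i : Fin k) → toℕ i mod k ≡ i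
mod-toℕ {k} i = toℕ-injective (trans (toℕ-mod (toℕ i) k) (m<n⇒m%n≡m (toℕ<n i)))

mod-cong : ∀ {x y} k .{{_ : NonZero k}} → x % k ≡ y % k → x mod k ≡ y mod k
mod-cong {x} {y} k eq = toℕ-injective (trans (toℕ-mod x k) (trans eq (sym (toℕ-mod y k))))

mod-+ : ∀ x l {k} .{{_ : NonZero k}} → (toℕ (x mod k) + l) mod k ≡ (x + l) mod k
mod-+ x l {k} = mod-cong k (begin
  (toℕ (x mod k) + l) % k    ≡⟨ cong (λ y → (y + l) % k) (toℕ-mod x k) ⟩
  (x % k + l) % k            ≡⟨ %-distribˡ-+ (x % k) l k ⟩
  (x % k % k + l % k) % k    ≡⟨ cong (λ y → (y + l % k) % k) (m%n%n≡m%n x k) ⟩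
  (x % k + l % k) % k        ≡⟨ %-distribˡ-+ x l k ⟨
  (x + l) % k                ∎)
  where open ≡-Reasoning

-- The indicator function of `A` pulled back to ℕ. Translation modulo `k` becomes ordinary addition,
-- and subsets for different moduli become comparable. On `k`-periodic sequences `restrict` is the
-- inverse.
χ : ∀ {k} .{{_ : NonZero k}} → Subset k → ℕ → Bool
χ {k} A x = lookup A (x mod k)

χ-periodic : ∀ {k} .{{_ : NonZero k}} (A : Subset k) → Periodic (χ A) k
χ-periodic {k} A x = cong (lookup A) (mod-cong k ([m+n]%n≡m%n x k))

restrict-χ : ∀ {k} .{{_ : NonZero k}} (A : Subset k) → restrict (χ A) k ≡ A
restrict-χ A = trans (tabulate-cong (cong (lookup A) ∘ mod-toℕ)) (tabulate∘lookup A)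

χ-restrict : ∀ {g} n .{{_ : NonZero n}} → Periodic g n → ∀ x → χ (restrict g n) x ≡ g x
χ-restrict {g} n per x = begin
  lookup (restrict g n) (x mod n) ≡⟨ lookup∘tabulate (g ∘ toℕ) (x mod n) ⟩
  g (toℕ (x mod n))               ≡⟨ cong g (toℕ-mod x n) ⟩
  g (x % n)                       ≡⟨ periodic-≡% per x ⟩
  g x                             ∎
  where open ≡-Reasoning

-- One turn around ℤ/k consists of `d` blocks of length `n`, all carrying the same pattern.
∣∣-periodic : ∀ {k} .{{_ : NonZero k}} (A : Subset k) n d → k ≡ d * n → Periodic (χ A) n →
              ∣ A ∣ ≡ d * count (χ A) n
∣∣-periodic {k} A n d k≡ per = begin
  ∣ A ∣                  ≡⟨ cong ∣_∣ (restrict-χ A) ⟨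
  ∣ restrict (χ A) k ∣   ≡⟨ ∣restrict∣ (χ A) k ⟩
  count (χ A) k         ≡⟨ cong (count (χ A)) k≡ ⟩
  count (χ A) (d * n)   ≡⟨ count-periodic n d per ⟩
  d * count (χ A) n     ∎
  where open ≡-Reasoning

-- Shifts modulo k and the least period.

module _ {k} .{{_ : NonZero k}} where

  ∈-residues⁺ : ∀ {a L} → a ∈ L → a mod k ∈ˢ residues k L
  ∈-residues⁺ {a} (here refl) = x∈p∪q⁺ (inj₁ (x∈⁅x⁆ (a mod k)))
  ∈-residues⁺ (there a∈)      = x∈p∪q⁺ (inj₂ (∈-residues⁺ a∈))

  ∈-residues⁻ : ∀ {i} L → i ∈ˢ residues k L → ∃[ a ] a ∈ L × i ≡ a mod k
  ∈-residues⁻ []      i∈ = ⊥-elim (∉⊥ i∈)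
  ∈-residues⁻ (a ∷ L) i∈ with x∈p∪q⁻ ⁅ a mod k ⁆ (residues k L) i∈
  ... | inj₁ i∈a = a , here refl , x∈⁅y⁆⇒x≡y (a mod k) i∈a
  ... | inj₂ i∈L with ∈-residues⁻ L i∈L
  ...   | b , b∈ , i≡ = b , there b∈ , i≡

  module _ (A : Subset k) where

    ∈-elements⁺ : ∀ {i} → i ∈ˢ A → toℕ i ∈ elements A
    ∈-elements⁺ {i} i∈ = ∈-map⁺ toℕ (∈-filter⁺ (_∈? A) (∈-allFin i) i∈)

    ∈-elements⁻ : ∀ {a} → a ∈ elements A → ∃[ i ] i ∈ˢ A × a ≡ toℕ i
    ∈-elements⁻ a∈ with ∈-map⁻ toℕ a∈
    ... | i , i∈ , a≡ = i , proj₂ (∈-filter⁻ (_∈? A) {xs = allFin k} i∈) , a≡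

    -- The listed elements are already reduced modulo `k`. Hence `IsShift` compares `A` itself with
    -- its translate.
    residues-elements : residues k (elements A) ≡ A
    residues-elements = ⊆-antisym to from
      where
      to : ∀ {i} → i ∈ˢ residues k (elements A) → i ∈ˢ A
      to i∈ with ∈-residues⁻ (elements A) i∈
      ... | a , a∈ , refl with ∈-elements⁻ a∈
      ...   | j , j∈ , refl = subst (_∈ˢ A) (sym (mod-toℕ j)) j∈

      from : ∀ {i} → i ∈ˢ A → i ∈ˢ residues k (elements A)
      from {i} i∈ = subst (_∈ˢ residues k (elements A)) (mod-toℕ i) (∈-residues⁺ (∈-elements⁺ i∈))

    ∈-shift⁺ : ∀ {i} l → i ∈ˢ A → (toℕ i + l) mod k ∈ˢ residues k (elements A ⊕ l)
    ∈-shift⁺ l i∈ = ∈-residues⁺ (∈-map⁺ (_+ l) (∈-elements⁺ i∈))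

    ∈-shift⁻ : ∀ {j} l → j ∈ˢ residues k (elements A ⊕ l) → ∃[ i ] i ∈ˢ A × j ≡ (toℕ i + l) mod k
    ∈-shift⁻ l j∈ with ∈-residues⁻ (elements A ⊕ l) j∈
    ... | _ , b∈ , refl with ∈-map⁻ (_+ l) b∈
    ...   | a , a∈ , refl with ∈-elements⁻ a∈
    ...     | i , i∈ , refl = i , i∈ , refl

    -- The reverse implication goes round the circle: x + l k has the same residue as x.

    shift-closed⇒periodic : ∀ {l} → (∀ x → χ A x ≡ true → χ A (x + l) ≡ true) → Periodic (χ A) l
    shift-closed⇒periodic {l} closed x = ⇔→≡ (mk⇔ back (closed x))
      where
      closed* : ∀ q y → χ A y ≡ true → χ A (y + q * l) ≡ true
      closed* zero    y p = trans (cong (χ A) (+-identityʳ y)) p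
      closed* (suc q) y p = trans (cong (χ A) (sym (+-assoc y l (q * l)))) (closed* q (y + l) (closed y p))

      back : χ A (x + l) ≡ true → χ A x ≡ true
      back p = begin
        χ A x                         ≡⟨ periodic-* l (χ-periodic A) x ⟨
        χ A (x + l * k)               ≡⟨ cong (λ y → χ A (x + y)) (trans (*-comm l k) (cong (_* l) (sym (suc-pred k)))) ⟩
        χ A (x + (l + pred k * l))    ≡⟨ cong (χ A) (+-assoc x l _) ⟨
        χ A (x + l + pred k * l)      ≡⟨ closed* (pred k) (x + l) p ⟩
        true                          ∎
        where open ≡-Reasoning

    isShift⇒periodic : ∀ {l} → IsShift k A l → Periodic (χ A) l
    isShift⇒periodic {l} (_ , A≡A⊕l) = shift-closed⇒periodic λ x p →
      trans (cong (lookup A) (sym (mod-+ x l))) ([]=⇒lookup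
        (subst ((toℕ (x mod k) + l) mod k ∈ˢ_) (trans (sym A≡A⊕l) residues-elements)
          (∈-shift⁺ l (lookup⇒[]= (x mod k) A p))))

    periodic⇒isShift : ∀ {l} → 0 < l → Periodic (χ A) l → IsShift k A l
    periodic⇒isShift {l} 0<l per = 0<l , trans residues-elements (⊆-antisym to from)
      where
      to : ∀ {j} → j ∈ˢ A → j ∈ˢ residues k (elements A ⊕ l)
      to {j} j∈ = subst (_∈ˢ residues k (elements A ⊕ l)) eq (∈-shift⁺ l i∈)
        where
        open ≡-Reasoning
        -- A preimage of `j` under the shift: `y` represents `j - l` modulo `k` without subtraction,
        -- since `y + l` equals `j + l * k`.
        y : ℕ
        y = toℕ j + pred k * l

        i∈ : y mod k ∈ˢ A
        i∈ = lookup⇒[]= (y mod k) A (begin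
          χ A y         ≡⟨ periodic-* (pred k) per (toℕ j) ⟩
          χ A (toℕ j)   ≡⟨ cong (lookup A) (mod-toℕ j) ⟩
          lookup A j    ≡⟨ []=⇒lookup j∈ ⟩
          true          ∎)

        y+l≡ : y + l ≡ toℕ j + l * k
        y+l≡ = begin
          toℕ j + pred k * l + l    ≡⟨ +-assoc (toℕ j) _ l ⟩
          toℕ j + (pred k * l + l)  ≡⟨ cong (λ c → toℕ j + c) (+-comm (pred k * l) l) ⟩
          toℕ j + (suc (pred k) * l) ≡⟨ cong (λ q → toℕ j + q * l) (suc-pred k) ⟩
          toℕ j + k * l             ≡⟨ cong (λ c → toℕ j + c) (*-comm k l) ⟩
          toℕ j + l * k             ∎

        eq : (toℕ (y mod k) + l) mod k ≡ j
        eq = trans (mod-+ y l) (trans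
          (mod-cong k (trans (cong (_% k) y+l≡) ([m+kn]%n≡m%n (toℕ j) l k))) (mod-toℕ j))

      from : ∀ {j} → j ∈ˢ residues k (elements A ⊕ l) → j ∈ˢ A
      from j∈ with ∈-shift⁻ l j∈
      ... | i , i∈ , refl = lookup⇒[]= ((toℕ i + l) mod k) A
        (trans (per (toℕ i)) (trans (cong (lookup A) (mod-toℕ i)) ([]=⇒lookup i∈)))

    0<f : 0 < f k A
    0<f = proj₁ (proj₁ (proj₂ (f-least k A)))

    f-periodic : Periodic (χ A) (f k A)
    f-periodic = isShift⇒periodic (proj₁ (proj₂ (f-least k A)))

    f∣⇒periodic : ∀ {l} → f k A ∣ l → Periodic (χ A) l
    f∣⇒periodic f∣l = periodic-∣ f∣l f-periodic

    -- A nonzero remainder of `l` modulo `f k A` would be a positive period below the least one.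
    periodic⇒f∣ : ∀ {l} → Periodic (χ A) l → f k A ∣ l
    periodic⇒f∣ {l} per = m%n≡0⇒n∣m l (f k A) (remainder≡0 (l % f k A) refl)
      where
      instance
        _ : NonZero (f k A)
        _ = >-nonZero 0<f
      remainder≡0 : ∀ r → l % f k A ≡ r → l % f k A ≡ 0
      remainder≡0 zero    eq = eq
      remainder≡0 (suc r) eq = ⊥-elim (<⇒≱ (m%n<n l (f k A))
        (proj₂ (proj₂ (f-least k A)) (l % f k A)
          (periodic⇒isShift (subst (0 <_) (sym eq) z<s) (periodic-% per f-periodic))))

    f∣k : f k A ∣ k
    f∣k = periodic⇒f∣ (χ-periodic A)

-- Counting subsets by size and by period.

-- Pascal's rule, splitting the subsets by whether they contain the first element.
∣𝒜∣ : ∀ j i → length (𝒜 j i) ≡ i C j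
∣𝒜∣ zero    zero    = refl
∣𝒜∣ (suc j) zero    = refl
∣𝒜∣ j (suc i) = begin
  length (𝒜 j (suc i))
    ≡⟨ cong length (filter-++ card? (map (outside ∷_) (subsets i)) (map (inside ∷_) (subsets i))) ⟩
  length (filter card? (map (outside ∷_) (subsets i)) ++ filter card? (map (inside ∷_) (subsets i)))
    ≡⟨ length-++ (filter card? (map (outside ∷_) (subsets i))) ⟩
  length (filter card? (map (outside ∷_) (subsets i))) + length (filter card? (map (inside ∷_) (subsets i)))
    ≡⟨ cong₂ _+_ (length-filter-map card? (outside ∷_) (subsets i)) (length-filter-map card? (inside ∷_) (subsets i)) ⟩
  length (𝒜 j i) + length (filter (λ A → suc ∣ A ∣ ≟ j) (subsets i))
    ≡⟨ pascal j ⟩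
  suc i C j ∎
  where
  open ≡-Reasoning
  card? : Decidable (λ (A : Subset (suc i)) → ∣ A ∣ ≡ j)
  card? A = ∣ A ∣ ≟ j

  length-filter-map : ∀ {A B : Set} {P : Pred B 0ℓ} (P? : Decidable P) (h : A → B) xs →
                      length (filter P? (map h xs)) ≡ length (filter (P? ∘ h) xs)
  length-filter-map P? h []       = refl
  length-filter-map P? h (x ∷ xs) with P? (h x)
  ... | yes _ = cong suc (length-filter-map P? h xs)
  ... | no  _ = length-filter-map P? h xs

  pascal : ∀ j → length (𝒜 j i) + length (filter (λ A → suc ∣ A ∣ ≟ j) (subsets i)) ≡ suc i C j
  -- A set containing the first element is not empty, so the second summand vanishes.
  pascal zero    = cong₂ _+_ (∣𝒜∣ 0 i) (cong length
    (filter-none (λ (A : Subset i) → suc ∣ A ∣ ≟ 0) (All.universal (λ _ ()) (subsets i))))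
  pascal (suc j) = begin
    length (𝒜 (suc j) i) + length (filter (λ A → suc ∣ A ∣ ≟ suc j) (subsets i))
      ≡⟨ cong₂ _+_ (∣𝒜∣ (suc j) i) (trans (cong length (filter-≐ _ _ (suc-injective , cong suc) (subsets i))) (∣𝒜∣ j i)) ⟩
    i C suc j + i C j
      ≡⟨ +-comm (i C suc j) (i C j) ⟩
    i C j + i C suc j
      ≡⟨ nCk+nC[k+1]≡[n+1]C[k+1] i j ⟩
    suc i C suc j ∎

∈-𝒜⁺ : ∀ {j i} {A : Subset i} → ∣ A ∣ ≡ j → A ∈ 𝒜 j i
∈-𝒜⁺ {j} {A = A} ∣A∣≡j = ∈-filter⁺ (λ A → ∣ A ∣ ≟ j) (∈-subsets A) ∣A∣≡j

∈-𝒜⁻ : ∀ {j i} {A : Subset i} → A ∈ 𝒜 j i → ∣ A ∣ ≡ j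
∈-𝒜⁻ {j} {i} A∈ = proj₂ (∈-filter⁻ (λ A → ∣ A ∣ ≟ j) {xs = subsets i} A∈)

𝒜-unique : ∀ j i → Unique (𝒜 j i)
𝒜-unique j i = filter⁺ (λ A → ∣ A ∣ ≟ j) (subsets-unique i)

-- By `periodic⇒f∣` and its converse, the sets counted are those with period `n`. Such a set is
-- determined by its first block, an arbitrary subset of ℤ/n, and repeating the block `d` times
-- multiplies its size by `d`.
∣𝒜-periodic∣ : ∀ {k r} .{{_ : NonZero k}} n m d .{{_ : NonZero n}} → k ≡ d * n → r ≡ d * m →
               length (filter (λ A → f k A ∣? n) (𝒜 r k)) ≡ n C m
∣𝒜-periodic∣ {k} {r} n m d k≡ r≡ = begin
  length (filter per? (𝒜 r k)) ≡⟨ ↭-length tiles ⟩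
  length (map tile (𝒜 m n))    ≡⟨ length-map tile (𝒜 m n) ⟩
  length (𝒜 m n)               ≡⟨ ∣𝒜∣ m n ⟩
  n C m                        ∎
  where
  open ≡-Reasoning
  instance
    _ : NonZero d
    _ = m*n≢0⇒m≢0 d {{subst NonZero k≡ it}}

  per? : Decidable (λ A → f k A ∣ n)
  per? A = f k A ∣? n

  tile : Subset n → Subset k
  tile B = restrict (χ B) k

  χ-tile : ∀ B x → χ (tile B) x ≡ χ B x
  χ-tile B = χ-restrict k (periodic-∣ (divides d k≡) (χ-periodic B))

  tile-periodic : ∀ B → Periodic (χ (tile B)) n
  tile-periodic B x = trans (χ-tile B (x + n)) (trans (χ-periodic B x) (sym (χ-tile B x)))

  untile : ∀ B → restrict (χ (tile B)) n ≡ B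
  untile B = trans (restrict-cong n (χ-tile B)) (restrict-χ B)

  tile-injective : ∀ {B C} → tile B ≡ tile C → B ≡ C
  tile-injective {B} {C} eq =
    trans (sym (untile B)) (trans (cong (λ A → restrict (χ A) n) eq) (untile C))

  tiles : filter per? (𝒜 r k) ↭ map tile (𝒜 m n)
  tiles = ⇔⇒↭ (filter⁺ per? (𝒜-unique r k)) (map⁺ tile-injective (𝒜-unique m n)) (mk⇔ to from)
    where
    to : ∀ {A} → A ∈ filter per? (𝒜 r k) → A ∈ map tile (𝒜 m n)
    to {A} A∈ with ∈-filter⁻ per? {xs = 𝒜 r k} A∈
    ... | A∈𝒜 , f∣n = subst (_∈ map tile (𝒜 m n)) tile-B (∈-map⁺ tile (∈-𝒜⁺ {A = B} ∣B∣))
      where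
      per : Periodic (χ A) n
      per = f∣⇒periodic A f∣n

      B : Subset n
      B = restrict (χ A) n

      tile-B : tile B ≡ A
      tile-B = trans (restrict-cong {χ B} {χ A} k (χ-restrict n per)) (restrict-χ A)

      ∣B∣ : ∣ B ∣ ≡ m
      ∣B∣ = *-cancelˡ-≡ ∣ B ∣ m d (begin
        d * ∣ B ∣           ≡⟨ cong (d *_) (∣restrict∣ (χ A) n) ⟩
        d * count (χ A) n  ≡⟨ ∣∣-periodic A n d k≡ per ⟨
        ∣ A ∣               ≡⟨ trans (∈-𝒜⁻ A∈𝒜) r≡ ⟩
        d * m              ∎)

    from : ∀ {A} → A ∈ map tile (𝒜 m n) → A ∈ filter per? (𝒜 r k)
    from A∈ with ∈-map⁻ tile A∈
    ... | B , B∈ , refl = ∈-filter⁺ per? (∈-𝒜⁺ ∣tile∣) (periodic⇒f∣ (tile B) (tile-periodic B))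
      where
      ∣tile∣ : ∣ tile B ∣ ≡ r
      ∣tile∣ = begin
        ∣ tile B ∣                 ≡⟨ ∣∣-periodic (tile B) n d k≡ (tile-periodic B) ⟩
        d * count (χ (tile B)) n  ≡⟨ cong (d *_) (∣restrict∣ (χ (tile B)) n) ⟨
        d * ∣ restrict (χ (tile B)) n ∣ ≡⟨ cong (λ B → d * ∣ B ∣) (untile B) ⟩
        d * ∣ B ∣                  ≡⟨ cong (d *_) (∈-𝒜⁻ B∈) ⟩
        d * m                     ≡⟨ r≡ ⟨
        r                         ∎

-- Möbius inversion over the periods.

module _ {k r} .{{_ : NonZero k}} n m d .{{_ : NonZero n}} .{{_ : NonZero d}}
         (k≡ : k ≡ d * n) (r≡ : r ≡ d * m) where

  private
    g : ℕ
    g = gcd n m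

    instance
      g≢0 : NonZero g
      g≢0 = ≢-nonZero (gcd[m,n]≢0 n m (inj₁ (≢-nonZero⁻¹ n)))

    -- Passing from `n`, `m`, `d` to `n / s`, `m / s`, `d * s` preserves both factorisations
    -- `k = d * n` and `r = d * m`.
    ∣𝒜-scaled∣ : ∀ {s} .{{_ : NonZero s}} → s ∣ g →
                 length (filter (λ A → f k A ∣? n / s) (𝒜 r k)) ≡ (n / s) C (m / s)
    ∣𝒜-scaled∣ {s} s∣g =
      ∣𝒜-periodic∣ (n / s) (m / s) (d * s) {{m/n≢0 s∣n}} (scale k≡ s∣n) (scale r≡ s∣m)
      where
      s∣n : s ∣ n
      s∣n = ∣-trans s∣g (gcd[m,n]∣m n m)

      s∣m : s ∣ m
      s∣m = ∣-trans s∣g (gcd[m,n]∣n n m)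

      m/n≢0 : s ∣ n → NonZero (n / s)
      m/n≢0 s∣n = m*n≢0⇒n≢0 s {{subst NonZero (sym (m*[n/m]≡n s∣n)) it}}

      scale : ∀ {x y} → x ≡ d * y → s ∣ y → x ≡ d * s * (y / s)
      scale {x} {y} x≡ s∣y = begin
        x                 ≡⟨ x≡ ⟩
        d * y             ≡⟨ cong (d *_) (m*[n/m]≡n s∣y) ⟨
        d * (s * (y / s)) ≡⟨ *-assoc d s (y / s) ⟨
        d * s * (y / s)   ∎
        where open ≡-Reasoning

    period∣? : ∀ A → Decidable (λ t → f k A ∣ n / suc t)
    period∣? A t = f k A ∣? n / suc t

    module _ {A : Subset k} (∣A∣≡r : ∣ A ∣ ≡ r) where

      p : ℕ
      p = f k A

      instance
        p≢0 : NonZero p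
        p≢0 = >-nonZero (0<f A)

      -- Since `k = d * e * p`, the set `A` consists of `d * e` equal blocks of length `p`. Its size
      -- `d * m` is then a multiple of `d * e`, and cancelling `d` gives `e ∣ m`.
      quotient∣g : ∀ {e} → n ≡ e * p → e ∣ g
      quotient∣g {e} n≡ = gcd-greatest (divides p (trans n≡ (*-comm e p))) e∣m
        where
        open ≡-Reasoning
        c : ℕ
        c = count (χ A) p

        e∣m : e ∣ m
        e∣m = divides c (*-cancelˡ-≡ m (c * e) d (begin
          d * m       ≡⟨ r≡ ⟨
          r           ≡⟨ ∣A∣≡r ⟨
          ∣ A ∣        ≡⟨ ∣∣-periodic A p (d * e) k≡dep (f-periodic A) ⟩
          d * e * c   ≡⟨ *-assoc d e c ⟩
          d * (e * c) ≡⟨ cong (d *_) (*-comm e c) ⟩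
          d * (c * e) ∎))
          where
          k≡dep : k ≡ d * e * p
          k≡dep = trans k≡ (trans (cong (d *_) n≡) (sym (*-assoc d e p)))

      -- For `s` dividing `n`, `p ∣ n / s` amounts to `s * p ∣ e * p`, that is, to `s ∣ e`. By
      -- `quotient∣g` every such `s` also divides `g`.
      divisors-period : ∀ {e} .{{_ : NonZero e}} → n ≡ e * p →
                        filter (period∣? A) (divisors g) ↭ divisors e
      divisors-period {e} n≡ =
        ⇔⇒↭ (filter⁺ (period∣? A) (divisors-unique g)) (divisors-unique e) (mk⇔ to from)
        where
        to : ∀ {t} → t ∈ filter (period∣? A) (divisors g) → t ∈ divisors e
        to {t} t∈ with ∈-filter⁻ (period∣? A) {xs = divisors g} t∈
        ... | t∈D , p∣n/t = ∈-divisors⁺ (*-cancelʳ-∣ p (subst (suc t * p ∣_) n≡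
          (m∣n/o⇒o*m∣n (∣-trans (∈-divisors⁻ g t∈D) (gcd[m,n]∣m n m)) p∣n/t)))

        from : ∀ {t} → t ∈ divisors e → t ∈ filter (period∣? A) (divisors g)
        from {t} t∈ = ∈-filter⁺ (period∣? A) (∈-divisors⁺ (∣-trans t∣e (quotient∣g n≡)))
          (m*n∣o⇒n∣o/m (suc t) p (subst (suc t * p ∣_) (sym n≡) (*-monoˡ-∣ p t∣e)))
          where
          t∣e : suc t ∣ e
          t∣e = ∈-divisors⁻ e t∈

      ∑μ-period : ∑ (filter (period∣? A) (divisors g)) (λ t → μ (suc t)) ≡ 𝟙 (p ≟ n)
      ∑μ-period with p ∣? n
      -- The sum is empty: if `p` divided some `n / s`, it would divide `n`.
      ... | no p∤n = trans (∑-zero {xs = filter (period∣? A) (divisors g)} none) (sym (𝟙-no (p ≟ n)))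
        where
        none : ∀ {t} → t ∈ filter (period∣? A) (divisors g) → μ (suc t) ≡ + 0
        none t∈ with ∈-filter⁻ (period∣? A) {xs = divisors g} t∈
        ... | t∈D , p∣n/t =
          ⊥-elim (p∤n (∣-trans p∣n/t (m/n∣m (∣-trans (∈-divisors⁻ g t∈D) (gcd[m,n]∣m n m)))))

        𝟙-no : ∀ d → 𝟙 d ≡ + 0
        𝟙-no (yes p≡n) = ⊥-elim (p∤n (∣-reflexive p≡n))
        𝟙-no (no _)    = refl
      ... | yes p∣n@(divides e n≡) = begin
        ∑ (filter (period∣? A) (divisors g)) (λ t → μ (suc t)) ≡⟨ ∑-↭ (λ t → μ (suc t)) (divisors-period {e = e} n≡) ⟩
        ∑ (divisors e) (λ t → μ (suc t))                      ≡⟨ ∑μ≡𝟙 e ⟩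
        𝟙 (e ≟ 1)                                             ≡⟨ 𝟙-cong (e ≟ 1) (p ≟ n) to from ⟩
        𝟙 (p ≟ n)                                             ∎
        where
        open ≡-Reasoning
        instance
          e≢0 : NonZero e
          e≢0 = quotient≢0 p∣n

        to : e ≡ 1 → p ≡ n
        to refl = sym (trans n≡ (*-identityˡ p))

        from : p ≡ n → e ≡ 1
        from p≡n = *-cancelʳ-≡ e 1 p (trans (sym n≡) (trans (sym p≡n) (sym (*-identityˡ p))))

  -- Stated for an arbitrary common factor `d` of `k` and `r`, so that it yields both formulas of
  -- the theorem: with `n` the period of a given set, and with `n = k`.
  ∣𝒜[n]∣ : + length (𝒜[ n ] r k) ≡ (∑[ s ∣ gcd n m ] + ((n / s) C (m / s)) *ᶻ μ s)
  ∣𝒜[n]∣ = sym (begin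
    -- The notation `∑∣` unfolds definitionally to this sum over encoded divisors.
    ∑ (divisors g) (λ t → + ((n / suc t) C (m / suc t)) *ᶻ μ (suc t))
      ≡⟨ ∑-cong {xs = divisors g} (λ {t} t∈ →
           cong (λ c → + c *ᶻ μ (suc t)) (sym (∣𝒜-scaled∣ (∈-divisors⁻ g t∈)))) ⟩
    ∑ (divisors g) (λ t → + length (filter (λ A → f k A ∣? n / suc t) (𝒜 r k)) *ᶻ μ (suc t))
      ≡⟨ ∑-fubini (λ t A → period∣? A t) (𝒜 r k) (divisors g) (λ t → μ (suc t)) ⟩
    ∑ (𝒜 r k) (λ A → ∑ (filter (period∣? A) (divisors g)) (λ t → μ (suc t)))
      ≡⟨ ∑-cong {xs = 𝒜 r k} (λ A∈ → ∑μ-period (∈-𝒜⁻ A∈)) ⟩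
    ∑ (𝒜 r k) (λ A → 𝟙 (f k A ≟ n))
      ≡⟨ ∑-𝟙 (λ A → f k A ≟ n) (𝒜 r k) ⟩
    + length (𝒜[ n ] r k) ∎)
    where open ≡-Reasoning

theorem1 : (k r : ℕ) → .{{_ : NonZero k}} → 2 ≤ k → 1 ≤ r → r ≤ k →
    ((A : Subset k) → ∣ A ∣ ≡ r →
    let n = f k A in
    n ∣ k ×
    (∃[ d ] ∃[ m ]
    0 < d × 0 < m × d ∣ r × k ≡ n * d × r ≡ m * d ×
    + length (𝒜[ n ] r k) ≡ (∑[ s ∣ gcd n m ] + ((n / s) C (m / s)) *ᶻ μ s))) ×
    + length (𝒜[ k ] r k) ≡ (∑[ s ∣ gcd k r ] + ((k / s) C (r / s)) *ᶻ μ s)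
-- The second formula is the case `d = 1`, in which `n = k` and `m = r`.
theorem1 k r _ 1≤r _ = byPeriod , ∣𝒜[n]∣ k r 1 (sym (*-identityˡ k)) (sym (*-identityˡ r))
  where
  byPeriod : (A : Subset k) → ∣ A ∣ ≡ r →
    let n = f k A in
    n ∣ k ×
    (∃[ d ] ∃[ m ]
    0 < d × 0 < m × d ∣ r × k ≡ n * d × r ≡ m * d ×
    + length (𝒜[ n ] r k) ≡ (∑[ s ∣ gcd n m ] + ((n / s) C (m / s)) *ᶻ μ s))
  byPeriod A ∣A∣≡r =
    n∣k , d , m , >-nonZero⁻¹ d , >-nonZero⁻¹ m {{m≢0}} , divides m r≡md ,
    trans k≡ (*-comm d n) , r≡md , ∣𝒜[n]∣ n m d k≡ r≡
    where
    n : ℕ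
    n = f k A

    n∣k : n ∣ k
    n∣k = f∣k A

    d m : ℕ
    d = quotient n∣k
    -- The number of elements of `A` in one period; the `d` periods together contain all `r`
    -- elements.
    m = count (χ A) n

    k≡ : k ≡ d * n
    k≡ = m∣n⇒n≡quotient*m n∣k

    r≡ : r ≡ d * m
    r≡ = trans (sym ∣A∣≡r) (∣∣-periodic A n d k≡ (f-periodic A))

    r≡md : r ≡ m * d
    r≡md = trans r≡ (*-comm d m)

    instance
      n≢0 : NonZero n
      n≢0 = >-nonZero (0<f A)

      d≢0 : NonZero d
      d≢0 = quotient≢0 n∣k

    -- Positivity of `m` comes from `1 ≤ r` through `r = m * d`.
    m≢0 : NonZero m
    m≢0 = m*n≢0⇒m≢0 m {{subst NonZero r≡md (>-nonZero 1≤r)}}
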